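{- Let $\Gamma$ be a finite set of formulas of $\mathcal{L}$. Then any tableau generated by $\mathcal{T}\mathbf{R}^{\mathbf{T}}$ for $\Gamma$ (i.e. starting with $\{x_0:F\mid F\in\Gamma\}$ for a label $x_0$, and respecting the restriction on the order of application of the rules) is finite.
   Context: **Language.** Propositional formulas ($A,B,\dots$) are built from a set $\mathit{ATM}$ of propositional variables with $\neg,\wedge,\vee,\rightarrow$. $\mathcal{L}$ consists of the boolean combinations of propositional formulas and conditionals $A\mathrel{|\!\sim}B$ ($A,B$ propositional); $\mathcal{L}_R$ extends $\mathcal{L}$ by formulas $\Box\neg A$ ($A$ propositional). $F,G$ denote arbitrary formulas. Let $\mathcal{A}$ be a denumerable alphabet of labels. Labelled formulas are world formulas $x:F$ ($x\in\mathcal{A}$, $F\in\mathcal{L}_R$) and relation formulas $x<y$ ($x,y\in\mathcal{A}$). **Calculus $\mathcal{T}\mathbf{R}^{\mathbf{T}}$.** Nodes are sets of labelled formulas. $\Gamma,\alpha$ means $\Gamma\cup\{\alpha\}$; in a rule with displayed premise $\Gamma,\alpha$ the principal formula $\alpha$ is not in $\Gamma$ (so it is removed unless displayed again in the conclusion). Each positive conditional carries a list $L$ of labels already used, written $u:A\mathrel{|\!\sim}B^{L}$ (initially empty). Let $\Gamma^M_{x\to y}=\{y:\neg A,\ y:\Box\neg A\mid x:\Box\neg A\in\Gamma\}$. Rules (premise $\leadsto$ conclusions, separated by $\mid$): - axioms: $\Gamma,x:P,x:\neg P$ with $P\in\mathit{ATM}$; and $\Gamma,x<y,y<x$; - boolean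 (propositional) rules: $\Gamma,x:\neg\neg F\leadsto\Gamma,x:F$; $\ \Gamma,x:F\wedge G\leadsto\Gamma,x:F,x:G$; $\ \Gamma,x:\neg(F\wedge G)\leadsto\Gamma,x:\neg F\mid\Gamma,x:\neg G$; $\ \Gamma,x:F\vee G\leadsto\Gamma,x:F\mid\Gamma,x:G$; $\ \Gamma,x:\neg(F\vee G)\leadsto\Gamma,x:\neg F,x:\neg G$; $\ \Gamma,x:F\rightarrow G\leadsto\Gamma,x:\neg F\mid\Gamma,x:G$; $\ \Gamma,x:\neg(F\rightarrow G)\leadsto\Gamma,x:F,x:\neg G$; - $(|\!\sim^+)$, for a label $x$ occurring in the premise with $x\notin L$: $\Gamma,u:A\mathrel{|\!\sim}B^{L}\leadsto\Gamma,x:\neg A,u:A\mathrel{|\!\sim}B^{L,x}\mid\Gamma,x:\neg\Box\neg A,u:A\mathrel{|\!\sim}B^{L,x}\mid\Gamma,x:B,u:A\mathrel{|\!\sim}B^{L,x}$; - $(|\!\sim^-)$, $x$ a new label: $\Gamma,u:\neg(A\mathrel{|\!\sim}B)\leadsto\Gamma,x:A,x:\Box\neg A,x:\neg B$; - $(\Box^-)$, $y$ a new label: $\Gamma,x:\neg\Box\neg A\leadsto\Gamma,y<x,\Gamma^M_{x\to y},y:A,y:\Box\neg A$; - $(<)$, for a label $z$ occurring in the premise such that neither $x<z$ nor $z<y$ belongs to the premise: $\Gamma,x<y\leadsto\Gamma,x<y,z<y,\Gamma^M_{y\to z}\mid\Gamma,x<y,x<z,\Gamma^M_{z\to x}$.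 A tableau is a tree of nodes in which the children of each non-leaf node are the conclusions of a rule applied to that node; a node that is an axiom closes its branch and is not expanded further. **Restriction on the order of application.** The application of $(\Box^-)$ is postponed to the application of all propositional rules and to the test of whether the node is an axiom: $(\Box^-)$ is applied only to nodes that are not axioms and to which no propositional rule is applicable. -}

module Defs where

open import Data.Bool using (if_then_else_)
open import Data.List using (List; []; _∷_; [_]; _++_; _∷ʳ_; map; concatMap; drop; head)
open import Data.List.Membership.Propositional using (_∈_; _∉_)
open import Data.List.Relation.Binary.BagAndSetEquality using (_∼[_]_; set)
open import Data.List.Relation.Binary.Pointwise using (Pointwise)
open import Data.List.Relation.Unary.Any using (Any)
open import Data.Maybe using (Maybe; just; nothing)
open import Data.Nat using (ℕ; _≡ᵇ_)
open import Data.Product using (∃; ∃-syntax; _×_)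
open import Data.Sum using (_⊎_)
open import Data.Unit using (⊤; tt)
open import Relation.Binary.PropositionalEquality using (_≡_)
open import Relation.Nullary using (¬_)

-- The denumerable alphabet of labels.
Label : Set
Label = ℕ

module TRT (ATM : Set) where

  infix  30 ~_ □~_
  infixr 25 _⋀_ _⋁_
  infixr 24 _⊃_
  infix  23 _|∼_
  infix  20 _∶_ _∶_^_ _<_

  data Propositional : Set where
    var         : ATM → Propositional
    ~_          : Propositional → Propositional
    _⋀_ _⋁_ _⊃_ : Propositional → Propositional → Propositional

  -- The language 𝓛_R.  Propositional formulas are not a separate constructor
  -- (see ⌜_⌝), so that each formula has a single representation; □~ A is the
  -- formula □¬A.
  data Formula : Set where
    var         : ATM → Formula
    _|∼_        : Propositional → Propositional → Formula
    □~_         : Propositional → Formula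
    ~_          : Formula → Formula
    _⋀_ _⋁_ _⊃_ : Formula → Formula → Formula

  -- The sublanguage 𝓛: no subformula □¬A.
  data In𝓛 : Formula → Set where
    var  : ∀ P → In𝓛 (var P)
    _|∼_ : ∀ A B → In𝓛 (A |∼ B)
    ~_   : ∀ {F} → In𝓛 F → In𝓛 (~ F)
    _⋀_  : ∀ {F G} → In𝓛 F → In𝓛 G → In𝓛 (F ⋀ G)
    _⋁_  : ∀ {F G} → In𝓛 F → In𝓛 G → In𝓛 (F ⋁ G)
    _⊃_  : ∀ {F G} → In𝓛 F → In𝓛 G → In𝓛 (F ⊃ G)

  ⌜_⌝ : Propositional → Formula
  ⌜ var P ⌝ = var P
  ⌜ ~ A   ⌝ = ~ ⌜ A ⌝
  ⌜ A ⋀ B ⌝ = ⌜ A ⌝ ⋀ ⌜ B ⌝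
  ⌜ A ⋁ B ⌝ = ⌜ A ⌝ ⋁ ⌜ B ⌝
  ⌜ A ⊃ B ⌝ = ⌜ A ⌝ ⊃ ⌜ B ⌝

  -- Only positive conditionals carry a list of already used labels.
  Annotation : Formula → Set
  Annotation (_ |∼ _) = List Label
  Annotation (var _)  = ⊤
  Annotation (□~ _)   = ⊤
  Annotation (~ _)    = ⊤
  Annotation (_ ⋀ _)  = ⊤
  Annotation (_ ⋁ _)  = ⊤
  Annotation (_ ⊃ _)  = ⊤

  initial : ∀ F → Annotation F
  initial (_ |∼ _) = []
  initial (var _)  = tt
  initial (□~ _)   = tt
  initial (~ _)    = tt
  initial (_ ⋀ _)  = tt
  initial (_ ⋁ _)  = tt
  initial (_ ⊃ _)  = tt

  data LabelledFormula : Set where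
    _∶_^_ : Label → (F : Formula) → Annotation F → LabelledFormula
    _<_   : Label → Label → LabelledFormula

  _∶_ : Label → Formula → LabelledFormula
  x ∶ F = x ∶ F ^ initial F

  -- Lists standing for finite sets: order and multiplicity are irrelevant
  -- because rules are applied up to set equality (see Apply).
  Node : Set
  Node = List LabelledFormula

  -- The labels in the list carried by a conditional count as occurring, so a
  -- new label is also new to these lists.
  data _OccursIn_ (x : Label) : LabelledFormula → Set where
    world      : ∀ {F a} → x OccursIn (x ∶ F ^ a)
    annotation : ∀ {u A B L} → x ∈ L → x OccursIn (u ∶ A |∼ B ^ L)
    left       : ∀ {y} → x OccursIn (x < y)
    right      : ∀ {y} → x OccursIn (y < x)

  _Occurs_ : Label → Node → Set
  x Occurs N = Any (x OccursIn_) N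

  transfer : Label → Label → LabelledFormula → Node
  transfer x y (z ∶ □~ A ^ _) = if x ≡ᵇ z then (y ∶ ~ ⌜ A ⌝) ∷ (y ∶ □~ A) ∷ [] else []
  transfer x y _              = []

  -- Γ ^M[ x ↦ y ] is  Γ^M_{x→y}.
  _^M[_↦_] : Node → Label → Label → Node
  Γ ^M[ x ↦ y ] = concatMap (transfer x y) Γ

  data Axiom (N : Node) : Set where
    clash : ∀ {x P} → (x ∶ var P) ∈ N → (x ∶ ~ var P) ∈ N → Axiom N
    cycle : ∀ {x y} → (x < y) ∈ N → (y < x) ∈ N → Axiom N

  -- In the following three families,  R Γ α Cs  means that  Γ , α  is the
  -- displayed premise of an instance of R, and Cs is its list of conclusions.

  data PropositionalRule (Γ : Node) : LabelledFormula → List Node → Set where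
    ~~ : ∀ {x F}   → PropositionalRule Γ (x ∶ ~ ~ F)
                       [ (x ∶ F) ∷ Γ ]
    ⋀⁺ : ∀ {x F G} → PropositionalRule Γ (x ∶ F ⋀ G)
                       [ (x ∶ F) ∷ (x ∶ G) ∷ Γ ]
    ⋀⁻ : ∀ {x F G} → PropositionalRule Γ (x ∶ ~ (F ⋀ G))
                       (((x ∶ ~ F) ∷ Γ) ∷ ((x ∶ ~ G) ∷ Γ) ∷ [])
    ⋁⁺ : ∀ {x F G} → PropositionalRule Γ (x ∶ F ⋁ G)
                       (((x ∶ F) ∷ Γ) ∷ ((x ∶ G) ∷ Γ) ∷ [])
    ⋁⁻ : ∀ {x F G} → PropositionalRule Γ (x ∶ ~ (F ⋁ G))
                       [ (x ∶ ~ F) ∷ (x ∶ ~ G) ∷ Γ ]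
    ⊃⁺ : ∀ {x F G} → PropositionalRule Γ (x ∶ F ⊃ G)
                       (((x ∶ ~ F) ∷ Γ) ∷ ((x ∶ G) ∷ Γ) ∷ [])
    ⊃⁻ : ∀ {x F G} → PropositionalRule Γ (x ∶ ~ (F ⊃ G))
                       [ (x ∶ F) ∷ (x ∶ ~ G) ∷ Γ ]

  data ConditionalOrOrderRule (Γ : Node) : LabelledFormula → List Node → Set where
    |∼⁺ : ∀ {u A B L} x → x Occurs ((u ∶ A |∼ B ^ L) ∷ Γ) → x ∉ L →
          ConditionalOrOrderRule Γ (u ∶ A |∼ B ^ L)
            ( ((x ∶ ~ ⌜ A ⌝)  ∷ (u ∶ A |∼ B ^ (L ∷ʳ x)) ∷ Γ)
            ∷ ((x ∶ ~ (□~ A)) ∷ (u ∶ A |∼ B ^ (L ∷ʳ x)) ∷ Γ)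
            ∷ ((x ∶ ⌜ B ⌝)    ∷ (u ∶ A |∼ B ^ (L ∷ʳ x)) ∷ Γ)
            ∷ [])
    |∼⁻ : ∀ {u A B} x → ¬ x Occurs ((u ∶ ~ (A |∼ B)) ∷ Γ) →
          ConditionalOrOrderRule Γ (u ∶ ~ (A |∼ B))
            [ (x ∶ ⌜ A ⌝) ∷ (x ∶ □~ A) ∷ (x ∶ ~ ⌜ B ⌝) ∷ Γ ]
    <-rule : ∀ {x y} z → z Occurs ((x < y) ∷ Γ) →
          (x < z) ∉ (x < y) ∷ Γ → (z < y) ∉ (x < y) ∷ Γ →
          ConditionalOrOrderRule Γ (x < y)
            ( ((x < y) ∷ (z < y) ∷ Γ ^M[ y ↦ z ] ++ Γ)
            ∷ ((x < y) ∷ (x < z) ∷ Γ ^M[ z ↦ x ] ++ Γ)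
            ∷ [])

  data BoxRule (Γ : Node) : LabelledFormula → List Node → Set where
    □⁻ : ∀ {x A} y → ¬ y Occurs ((x ∶ ~ (□~ A)) ∷ Γ) →
         BoxRule Γ (x ∶ ~ (□~ A))
           [ (y < x) ∷ Γ ^M[ x ↦ y ] ++ (y ∶ ⌜ A ⌝) ∷ (y ∶ □~ A) ∷ Γ ]

  -- The node N is, as a set, Γ ∪ {α} with α ∉ Γ, and the nodes Cs are, as
  -- sets, the conclusions of an instance of R with premise  Γ , α.
  Apply : (Node → LabelledFormula → List Node → Set) → Node → List Node → Set
  Apply R N Cs = ∃[ Γ ] ∃[ α ] ∃[ Ds ]
    N ∼[ set ] (α ∷ Γ) × α ∉ Γ × R Γ α Ds × Pointwise _∼[ set ]_ Cs Ds

  data _⟶_ (N : Node) (Cs : List Node) : Set where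
    propositional      : ¬ Axiom N → Apply PropositionalRule N Cs → N ⟶ Cs
    conditionalOrOrder : ¬ Axiom N → Apply ConditionalOrOrderRule N Cs → N ⟶ Cs
    box                : ¬ Axiom N → ¬ (∃ λ Ds → Apply PropositionalRule N Ds) →
                         Apply BoxRule N Cs → N ⟶ Cs

  -- A position is the list of child indices leading to it from the root, and a
  -- possibly infinite tree maps each of its positions to the node found there
  -- and every other position to nothing.
  Position : Set
  Position = List ℕ

  Tree : Set
  Tree = Position → Maybe Node

  HasChildren : Tree → Position → List Node → Set
  HasChildren t p Cs = ∀ i → t (p ∷ʳ i) ≡ head (drop i Cs)

  -- Leaves are arbitrary: a tableau need not be fully expanded.
  record IsTableau (N₀ : Node) (t : Tree) : Set where
    field
      root     : t [] ≡ just N₀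
      outside  : ∀ p → t p ≡ nothing → HasChildren t p []
      expanded : ∀ p N → t p ≡ just N →
                 ∃[ Cs ] ((Cs ≡ [] ⊎ N ⟶ Cs) × HasChildren t p Cs)

  IsTableauFor : List Formula → Tree → Set
  IsTableauFor Γ t = ∃[ x₀ ] IsTableau (map (x₀ ∶_) Γ) t

  Finite : Tree → Set
  Finite t = ∃[ ps ] (∀ p N → t p ≡ just N → p ∈ ps)

module Submission where

-- Why every tableau is finite.  A tableau is a finitely branching tree, so it
-- suffices that the calculus terminates (Terminating, finite): no infinite
-- chain of nodes, each a conclusion of a rule applied to the previous one,
-- starts from the root.  While no label is created, termination is clear: a
-- conditional is used at most once for each label, the order rule adds a
-- relation that was absent, and the propositional rules decompose formulas.
-- The rule for negated conditionals creates labels, but consumes a formula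
-- obtained by decomposing Γ and adds only propositional formulas and a box.
-- The crux is the rule for ¬□¬A.
--
-- A formula x : ¬□¬A comes from a positive conditional A |∼ B, so A is one of
-- the finitely many antecedents of the conditionals of Γ.  The label y created
-- for it carries □¬A and inherits every □¬A′ of x, and boxes are never removed.
-- If x : □¬A is absent, the set of antecedents not yet boxed therefore shrinks
-- from x to y; this bounds the depth of label creation, and the number of
-- conditionals bounds its branching.  If x : □¬A is present, y receives both A
-- and ¬A.  From then on the rule is never applied again: it applies only to
-- nodes that are not axioms and are saturated under the propositional rules,
-- and in a saturated node the decompositions of A and ¬A end in complementary
-- literals (saturated-inconsistent).
--
-- The argument becomes a well-founded measure on a State of the node, that is
-- a list of tokens covering its formulas.  A rule replaces the token of its
-- principal formula by tokens for the formulas it adds.  The measure is, in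
-- lexicographic order:
--   * the size of the formulas that stem from the decomposition of Γ, plus one
--     as long as no label is known to carry some A and ¬A;
--   * the cost of all applications of the rule for ¬□¬A still possible;
--   * the number of relations x < y that are possibly still absent;
--   * the size of the other propositional formulas.
-- Each rule decreases it (the lemmas named ...-progress).
--
-- Equality of formulas need not be decidable, as ATM is arbitrary, so nodes
-- cannot be counted or purged of repetitions.  The covering needs neither: if N
-- is Γ together with α ∉ Γ, and p is the position of the token of α, then no
-- formula of Γ has its token at p, so deleting p still leaves Γ covered.

open import Data.Bool using (true; false)
open import Data.Empty using (⊥; ⊥-elim)
open import Data.List
  using (List; []; _∷_; [_]; _++_; _∷ʳ_; map; concatMap; length; drop; head; cartesianProduct)
open import Data.List.Membership.Propositional using (_∈_; _∉_; find; lose)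
open import Data.List.Membership.Propositional.Properties
  using (∈-++⁺ˡ; ∈-++⁺ʳ; ∈-++⁻; ∈-map⁺; ∈-concatMap⁺; ∈-cartesianProduct⁺)
open import Data.List.Properties using (++-assoc; ++-identityʳ; ∷ʳ-++; map-++; length-removeAt′)
open import Data.List.Relation.Binary.BagAndSetEquality using (_∼[_]_; set)
open import Data.List.Relation.Binary.Pointwise using (Pointwise; []; _∷_)
open import Data.List.Relation.Binary.Subset.Propositional using (_⊆_)
open import Data.List.Relation.Binary.Subset.Propositional.Properties using (Any-resp-⊆)
open import Data.List.Relation.Unary.All as All using (All; []; _∷_)
import Data.List.Relation.Unary.All.Properties as Allₚ
open import Data.List.Relation.Unary.Any as Any using (Any; here; there; _─_)
import Data.List.Relation.Unary.Any.Properties as Anyₚ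
open import Data.Maybe using (just; nothing)
open import Data.Nat as ℕ using (ℕ; zero; suc; _+_; _*_; _≡ᵇ_)
open import Data.Nat.ListAction using (sum)
open import Data.Nat.ListAction.Properties using (sum-++)
open import Data.Nat.Induction using (<-wellFounded)
import Data.Nat.Properties as ℕₚ
open import Data.Nat.Tactic.RingSolver using (solve-∀)
open import Data.Product as Product using (∃; ∃-syntax; _×_; _,_; proj₁; proj₂)
open import Data.Product.Relation.Binary.Lex.Strict using (×-Lex; ×-wellFounded)
open import Data.Sum as Sum using (_⊎_; inj₁; inj₂)
open import Data.Unit using (⊤; tt)
open import Function using (_∘_; id; Equivalence; mk⇔; case_of_)
open import Induction.WellFounded using (WellFounded; Acc; acc)
open import Relation.Binary.PropositionalEquality
  using (_≡_; _≢_; refl; sym; trans; cong; cong₂; subst; subst₂; module ≡-Reasoning)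
open import Relation.Nullary using (¬_; yes; no; contradiction; ¬¬-excluded-middle)

open import Defs

------------------------------------------------------------------------
-- Lists with one occurrence removed

module _ {A : Set} where

  ∈-─ : ∀ {x y : A} {xs} (p : x ∈ xs) → y ∈ xs → y ≡ x ⊎ y ∈ (xs ─ p)
  ∈-─ (here refl) (here refl) = inj₁ refl
  ∈-─ (here refl) (there q)   = inj₂ q
  ∈-─ (there p)   (here refl) = inj₂ (here refl)
  ∈-─ (there p)   (there q)   = Sum.map₂ there (∈-─ p q)

  total : (A → ℕ) → List A → ℕ
  total f xs = sum (map f xs)

  total-─ : ∀ f {x : A} {xs} (p : x ∈ xs) → total f xs ≡ f x + total f (xs ─ p)
  total-─ f (here refl)               = refl
  total-─ f {x} (there {x = y} {xs = xs} p) = begin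
    f y + total f xs               ≡⟨ cong (f y +_) (total-─ f p) ⟩
    f y + (f x + total f (xs ─ p)) ≡⟨ ℕₚ.+-assoc (f y) (f x) _ ⟨
    f y + f x + total f (xs ─ p)   ≡⟨ cong (_+ total f (xs ─ p)) (ℕₚ.+-comm (f y) (f x)) ⟩
    f x + f y + total f (xs ─ p)   ≡⟨ ℕₚ.+-assoc (f x) (f y) _ ⟩
    f x + (f y + total f (xs ─ p)) ∎
    where open ≡-Reasoning

  total-++ : ∀ f (xs ys : List A) → total f (xs ++ ys) ≡ total f xs + total f ys
  total-++ f xs ys = trans (cong sum (map-++ f xs ys)) (sum-++ (map f xs) (map f ys))

  head-drop-[] : ∀ i → head (drop i ([] {A = A})) ≡ nothing
  head-drop-[] zero    = refl
  head-drop-[] (suc i) = refl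

  -- Equality of elements need not be decidable, so an element can be deleted
  -- from a list only up to double negation.
  ¬¬-delete : ∀ (x : A) xs → ¬ ¬ (∃[ ys ] x ∉ ys × (x ∷ xs) ∼[ set ] (x ∷ ys))
  ¬¬-delete x []       k = k ([] , (λ ()) , mk⇔ id id)
  ¬¬-delete x (y ∷ xs) k = ¬¬-delete x xs λ (ys , x∉ys , eq) →
    ¬¬-excluded-middle {A = x ≡ y} λ where
      (yes refl) → k (ys , x∉ys , mk⇔
        (λ { (here e) → here e ; (there q) → Equivalence.to eq q })
        (λ q → there (Equivalence.from eq q)))
      (no x≢y) → k (y ∷ ys , (λ { (here e) → x≢y e ; (there q) → x∉ys q }) , mk⇔
        (λ { (here e)          → here e
           ; (there (here e))  → there (here e)
           ; (there (there q)) → insert (Equivalence.to eq (there q)) })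
        (λ { (here e)          → here e
           ; (there (here e))  → there (here e)
           ; (there (there q)) → insert (Equivalence.from eq (there q)) }))
    where
    insert : ∀ {z zs} → z ∈ x ∷ zs → z ∈ x ∷ y ∷ zs
    insert (here e)  = here e
    insert (there q) = there (there q)

------------------------------------------------------------------------
-- Finiteness of tableaux from termination of the calculus

module _ (ATM : Set) where
  open TRT ATM

  -- No infinite sequence of nodes, each a conclusion of a rule applied to the
  -- previous one, starts from N.
  data Terminating (N : Node) : Set where
    terminating : (∀ {Cs} → N ⟶ Cs → All Terminating Cs) → Terminating N

  module _ {N₀ : Node} {t : Tree} (tableau : IsTableau N₀ t) where
    open IsTableau tableau

    -- Finitely many positions extending p carry a node.
    FiniteBelow : Position → Set
    FiniteBelow p = ∃[ ps ] (∀ q N → t (p ++ q) ≡ just N → p ++ q ∈ ps)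

    nothing-below : ∀ p q → t p ≡ nothing → t (p ++ q) ≡ nothing
    nothing-below p []      e = trans (cong t (++-identityʳ p)) e
    nothing-below p (i ∷ q) e = trans (cong t (sym (∷ʳ-++ p i q)))
      (nothing-below (p ∷ʳ i) q (trans (outside p e i) (head-drop-[] i)))

    -- The same for all the positions  child 0, child 1, ...  together.
    FiniteBelowAll : (ℕ → Position) → Set
    FiniteBelowAll child =
      ∃[ ps ] (∀ i q N → t (child i ++ q) ≡ just N → child i ++ q ∈ ps)

    with-children : ∀ p → FiniteBelowAll (p ∷ʳ_) → FiniteBelow p
    with-children p (ps , complete) = p ∷ ps , λ where
      []      _ _ → here (++-identityʳ p)
      (i ∷ q) N e → there (subst (_∈ ps) (∷ʳ-++ p i q)
                      (complete i q N (trans (cong t (∷ʳ-++ p i q)) e)))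

    finite-below     : ∀ p {N} → Terminating N → t p ≡ just N → FiniteBelow p
    finite-below-all : ∀ {Cs} → All Terminating Cs → (child : ℕ → Position) →
      (∀ i → t (child i) ≡ head (drop i Cs)) → FiniteBelowAll child

    finite-below p {N} (terminating next) e with expanded p N e
    ... | _ , inj₁ refl , children = with-children p (finite-below-all [] (p ∷ʳ_) children)
    ... | _ , inj₂ step , children =
      with-children p (finite-below-all (next step) (p ∷ʳ_) children)

    finite-below-all [] child e = [] , λ i q N d →
      case trans (sym d) (nothing-below (child i) q (trans (e i) (head-drop-[] i))) of λ ()
    finite-below-all (T ∷ Ts) child e =
      let ps , complete  = finite-below (child 0) T (e 0)
          qs , complete′ = finite-below-all Ts (child ∘ suc) (e ∘ suc)
      in ps ++ qs , λ where
        zero    q N d → ∈-++⁺ˡ (complete q N d)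
        (suc i) q N d → ∈-++⁺ʳ ps (complete′ i q N d)

    finite : Terminating N₀ → Finite t
    finite T = finite-below [] T root

------------------------------------------------------------------------
-- Labels carrying both A and ¬A

  -- Formulas without □ all of whose conditionals have an antecedent in P.
  data Over (P : Propositional → Set) : Formula → Set where
    var         : ∀ Q → Over P (var Q)
    conditional : ∀ {A B} → P A → Over P (A |∼ B)
    ~_          : ∀ {F} → Over P F → Over P (~ F)
    _⋀_         : ∀ {F G} → Over P F → Over P G → Over P (F ⋀ G)
    _⋁_         : ∀ {F G} → Over P F → Over P G → Over P (F ⋁ G)
    _⊃_         : ∀ {F G} → Over P F → Over P G → Over P (F ⊃ G)

  -- The propositional formulas, as a predicate on 𝓛_R.
  Simple : Formula → Set
  Simple = Over (λ _ → ⊥)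

  ⌜_⌝-simple : ∀ A → Simple ⌜ A ⌝
  ⌜ var P ⌝-simple = var P
  ⌜ ~ A ⌝-simple   = ~ ⌜ A ⌝-simple
  ⌜ A ⋀ B ⌝-simple = ⌜ A ⌝-simple ⋀ ⌜ B ⌝-simple
  ⌜ A ⋁ B ⌝-simple = ⌜ A ⌝-simple ⋁ ⌜ B ⌝-simple
  ⌜ A ⊃ B ⌝-simple = ⌜ A ⌝-simple ⊃ ⌜ B ⌝-simple

  -- x : F is in N, or the propositional rules have replaced it by formulas
  -- that are themselves realised in N.
  data Realised (N : Node) (x : Label) : Formula → Set where
    present : ∀ {F}   → (x ∶ F) ∈ N → Realised N x F
    ~~      : ∀ {F}   → Realised N x F → Realised N x (~ ~ F)
    ⋀⁺      : ∀ {F G} → Realised N x F → Realised N x G → Realised N x (F ⋀ G)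
    ⋀⁻₁     : ∀ {F G} → Realised N x (~ F) → Realised N x (~ (F ⋀ G))
    ⋀⁻₂     : ∀ {F G} → Realised N x (~ G) → Realised N x (~ (F ⋀ G))
    ⋁⁺₁     : ∀ {F G} → Realised N x F → Realised N x (F ⋁ G)
    ⋁⁺₂     : ∀ {F G} → Realised N x G → Realised N x (F ⋁ G)
    ⋁⁻      : ∀ {F G} → Realised N x (~ F) → Realised N x (~ G) → Realised N x (~ (F ⋁ G))
    ⊃⁺₁     : ∀ {F G} → Realised N x (~ F) → Realised N x (F ⊃ G)
    ⊃⁺₂     : ∀ {F G} → Realised N x G → Realised N x (F ⊃ G)
    ⊃⁻      : ∀ {F G} → Realised N x F → Realised N x (~ G) → Realised N x (~ (F ⊃ G))

  -- Some label carries a propositional formula and its negation.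
  Inconsistent : Node → Set
  Inconsistent N = ∃[ x ] ∃[ A ] (Realised N x ⌜ A ⌝ × Realised N x (~ ⌜ A ⌝))

  realised-bind : ∀ {N C x} →
    (∀ {F} → Simple F → (x ∶ F) ∈ N → Realised C x F) →
    ∀ {F} → Simple F → Realised N x F → Realised C x F
  realised-bind f s             (present i) = f s i
  realised-bind f (~ ~ s)       (~~ r)      = ~~ (realised-bind f s r)
  realised-bind f (s ⋀ s′)      (⋀⁺ r r′)   = ⋀⁺ (realised-bind f s r) (realised-bind f s′ r′)
  realised-bind f (~ (s ⋀ s′))  (⋀⁻₁ r)     = ⋀⁻₁ (realised-bind f (~ s) r)
  realised-bind f (~ (s ⋀ s′))  (⋀⁻₂ r)     = ⋀⁻₂ (realised-bind f (~ s′) r)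
  realised-bind f (s ⋁ s′)      (⋁⁺₁ r)     = ⋁⁺₁ (realised-bind f s r)
  realised-bind f (s ⋁ s′)      (⋁⁺₂ r)     = ⋁⁺₂ (realised-bind f s′ r)
  realised-bind f (~ (s ⋁ s′))  (⋁⁻ r r′)   = ⋁⁻ (realised-bind f (~ s) r) (realised-bind f (~ s′) r′)
  realised-bind f (s ⊃ s′)      (⊃⁺₁ r)     = ⊃⁺₁ (realised-bind f (~ s) r)
  realised-bind f (s ⊃ s′)      (⊃⁺₂ r)     = ⊃⁺₂ (realised-bind f s′ r)
  realised-bind f (~ (s ⊃ s′))  (⊃⁻ r r′)   = ⊃⁻ (realised-bind f s r) (realised-bind f (~ s′) r′)

  -- Removing the principal formula α does no harm once it is realised.
  inconsistent-step : ∀ {N α Γ C} → N ∼[ set ] (α ∷ Γ) → Γ ⊆ C →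
    (∀ {x F} → Simple F → α ≡ (x ∶ F) → Realised C x F) →
    Inconsistent N → Inconsistent C
  inconsistent-step {N} {α} {Γ} {C} N∼ Γ⊆C principal (x , A , r , r′) =
    x , A , realised-bind keep ⌜ A ⌝-simple r , realised-bind keep (~ ⌜ A ⌝-simple) r′
    where
    keep : ∀ {F} → Simple F → (x ∶ F) ∈ N → Realised C x F
    keep s i with Equivalence.to N∼ i
    ... | here e  = principal s (sym e)
    ... | there j = present (Γ⊆C j)

  -- The conclusions of a propositional rule realise its principal formula.
  principal-realised : ∀ {Γ x F a Ds D C} → PropositionalRule Γ (x ∶ F ^ a) Ds → D ∈ Ds →
    D ⊆ C → Realised C x F
  principal-realised ~~ (here refl)         D⊆C = ~~ (present (D⊆C (here refl)))
  principal-realised ⋀⁺ (here refl)         D⊆C = ⋀⁺ (present (D⊆C (here refl))) (present (D⊆C (there (here refl))))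
  principal-realised ⋀⁻ (here refl)         D⊆C = ⋀⁻₁ (present (D⊆C (here refl)))
  principal-realised ⋀⁻ (there (here refl)) D⊆C = ⋀⁻₂ (present (D⊆C (here refl)))
  principal-realised ⋁⁺ (here refl)         D⊆C = ⋁⁺₁ (present (D⊆C (here refl)))
  principal-realised ⋁⁺ (there (here refl)) D⊆C = ⋁⁺₂ (present (D⊆C (here refl)))
  principal-realised ⋁⁻ (here refl)         D⊆C = ⋁⁻ (present (D⊆C (here refl))) (present (D⊆C (there (here refl))))
  principal-realised ⊃⁺ (here refl)         D⊆C = ⊃⁺₁ (present (D⊆C (here refl)))
  principal-realised ⊃⁺ (there (here refl)) D⊆C = ⊃⁺₂ (present (D⊆C (here refl)))
  principal-realised ⊃⁻ (here refl)         D⊆C = ⊃⁻ (present (D⊆C (here refl))) (present (D⊆C (there (here refl))))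

  -- No propositional rule is applicable.
  Saturated : Node → Set
  Saturated N = ¬ (∃ λ Cs → Apply PropositionalRule N Cs)

  ∼-refls : (Ds : List Node) → Pointwise _∼[ set ]_ Ds Ds
  ∼-refls []       = []
  ∼-refls (D ∷ Ds) = mk⇔ id id ∷ ∼-refls Ds

  saturated-∌ : ∀ {N α} → Saturated N →
    (∀ Γ → ∃ (PropositionalRule Γ α)) → α ∉ N
  saturated-∌ {N} {α} saturated rule α∈N = ¬¬-delete α N λ (Γ , α∉Γ , eq) →
    let Ds , r = rule Γ in
    saturated (Ds , Γ , α , Ds ,
      mk⇔ (λ i → Equivalence.to eq (there i))
          (λ i → case Equivalence.from eq i of λ { (here refl) → α∈N ; (there j) → j }) ,
      α∉Γ , r , ∼-refls Ds)

  -- Decomposing A and ¬A completely ends in complementary literals.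
  saturated-inconsistent : ∀ {N} → ¬ Axiom N → Saturated N → ¬ Inconsistent N
  saturated-inconsistent {N} open′ saturated (x , A , r , r′) = clashing A r r′
    where
    rule-applies : ∀ {F} → (x ∶ F) ∈ N → (∀ Γ → ∃ (PropositionalRule Γ (x ∶ F))) → ⊥
    rule-applies i rule = saturated-∌ saturated rule i

    clashing : ∀ A → Realised N x ⌜ A ⌝ → Realised N x (~ ⌜ A ⌝) → ⊥
    clashing (var P) (present i)  (present j)  = open′ (clash i j)
    clashing (~ A)   r            (present j)  = rule-applies j (λ _ → _ , ~~)
    clashing (~ A)   r            (~~ r′)      = clashing A r′ r
    clashing (A ⋀ B) (present i)  _            = rule-applies i (λ _ → _ , ⋀⁺)
    clashing (A ⋀ B) _            (present j)  = rule-applies j (λ _ → _ , ⋀⁻)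
    clashing (A ⋀ B) (⋀⁺ r s)     (⋀⁻₁ r′)     = clashing A r r′
    clashing (A ⋀ B) (⋀⁺ r s)     (⋀⁻₂ s′)     = clashing B s s′
    clashing (A ⋁ B) (present i)  _            = rule-applies i (λ _ → _ , ⋁⁺)
    clashing (A ⋁ B) _            (present j)  = rule-applies j (λ _ → _ , ⋁⁻)
    clashing (A ⋁ B) (⋁⁺₁ r)      (⋁⁻ r′ s′)   = clashing A r r′
    clashing (A ⋁ B) (⋁⁺₂ s)      (⋁⁻ r′ s′)   = clashing B s s′
    clashing (A ⊃ B) (present i)  _            = rule-applies i (λ _ → _ , ⊃⁺)
    clashing (A ⊃ B) _            (present j)  = rule-applies j (λ _ → _ , ⊃⁻)
    clashing (A ⊃ B) (⊃⁺₁ r′)     (⊃⁻ r s′)    = clashing A r r′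
    clashing (A ⊃ B) (⊃⁺₂ s)      (⊃⁻ r s′)    = clashing B s s′

------------------------------------------------------------------------
-- Labels occurring in a node

  annotationLabels : ∀ F → Annotation F → List Label
  annotationLabels (_ |∼ _) L = L
  annotationLabels (var _)  _ = []
  annotationLabels (□~ _)   _ = []
  annotationLabels (~ _)    _ = []
  annotationLabels (_ ⋀ _)  _ = []
  annotationLabels (_ ⋁ _)  _ = []
  annotationLabels (_ ⊃ _)  _ = []

  labelsOf : LabelledFormula → List Label
  labelsOf (x ∶ F ^ a) = x ∷ annotationLabels F a
  labelsOf (x < y)     = x ∷ y ∷ []

  labels : Node → List Label
  labels = concatMap labelsOf

  occurs⇒∈labels : ∀ {x} N → x Occurs N → x ∈ labels N
  occurs⇒∈labels {x} N o = ∈-concatMap⁺ labelsOf (Any.map occursIn⇒∈ o)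
    where
    occursIn⇒∈ : ∀ {φ} → x OccursIn φ → x ∈ labelsOf φ
    occursIn⇒∈ world          = here refl
    occursIn⇒∈ (annotation i) = there i
    occursIn⇒∈ left           = here refl
    occursIn⇒∈ right          = there (here refl)

  occursIn-initial : ∀ {x y} F → x OccursIn (y ∶ F) → x ≡ y
  occursIn-initial (_ |∼ _) world           = refl
  occursIn-initial (_ |∼ _) (annotation ())
  occursIn-initial (var _)  world           = refl
  occursIn-initial (□~ _)   world           = refl
  occursIn-initial (~ _)    world           = refl
  occursIn-initial (_ ⋀ _)  world           = refl
  occursIn-initial (_ ⋁ _)  world           = refl
  occursIn-initial (_ ⊃ _)  world           = refl

  -- The elements of Γ ^M[ x ↦ y ].
  data Transferred (y : Label) : LabelledFormula → Set where
    negation : ∀ A → Transferred y (y ∶ ~ ⌜ A ⌝)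
    box      : ∀ A → Transferred y (y ∶ □~ A)

  transferred : ∀ Γ x y → All (Transferred y) (Γ ^M[ x ↦ y ])
  transferred []      x y = []
  transferred (φ ∷ Γ) x y = Allₚ.++⁺ (from φ) (transferred Γ x y)
    where
    from : ∀ φ → All (Transferred y) (transfer x y φ)
    from (z ∶ □~ A ^ _) with x ≡ᵇ z
    ... | true  = negation A ∷ box A ∷ []
    ... | false = []
    from (_ ∶ var _ ^ _)  = []
    from (_ ∶ _ |∼ _ ^ _) = []
    from (_ ∶ ~ _ ^ _)    = []
    from (_ ∶ _ ⋀ _ ^ _)  = []
    from (_ ∶ _ ⋁ _ ^ _)  = []
    from (_ ∶ _ ⊃ _ ^ _)  = []
    from (_ < _)          = []

  transfer-box : ∀ {Γ x A} y → (x ∶ □~ A) ∈ Γ →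
    (y ∶ ~ ⌜ A ⌝) ∈ Γ ^M[ x ↦ y ] × (y ∶ □~ A) ∈ Γ ^M[ x ↦ y ]
  transfer-box {x = x} y (here refl) with x ≡ᵇ x | ℕₚ.≡⇒≡ᵇ x x refl
  ... | true | _ = here refl , there (here refl)
  transfer-box {φ ∷ _} {x} y (there i) =
    Product.map (∈-++⁺ʳ (transfer x y φ)) (∈-++⁺ʳ (transfer x y φ)) (transfer-box y i)

------------------------------------------------------------------------
-- Decomposition by the propositional rules

  -- The weight 2 of binary connectives makes ~ F and ~ G together smaller than
  -- ~ (F ⋁ G).
  size : Formula → ℕ
  size (var _)  = 1
  size (_ |∼ _) = 1
  size (□~ _)   = 1
  size (~ F)    = 1 + size F
  size (F ⋀ G)  = 2 + (size F + size G)
  size (F ⋁ G)  = 2 + (size F + size G)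
  size (F ⊃ G)  = 2 + (size F + size G)

  single : ∀ m {n} → m ℕ.≤ n → m + 0 ℕ.≤ n
  single m = subst (ℕ._≤ _) (sym (ℕₚ.+-identityʳ m))

  pair : ∀ m₁ m₂ {n} → m₁ + m₂ ℕ.≤ n → m₁ + (m₂ + 0) ℕ.≤ n
  pair m₁ m₂ = subst (λ m → m₁ + m ℕ.≤ _) (sym (ℕₚ.+-identityʳ m₂))

  decompose : ∀ {P Γ x F a Ds D} → Over P F → PropositionalRule Γ (x ∶ F ^ a) Ds → D ∈ Ds →
    ∃[ Fs ] D ≡ map (x ∶_) Fs ++ Γ × All (Over P) Fs × total size Fs ℕ.< size F
  decompose (~ (~_ {F} s)) ~~ (here refl) =
    F ∷ [] , refl , s ∷ [] , ℕ.s≤s (single (size F) (ℕₚ.n≤1+n _))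
  decompose (_⋀_ {F} {G} s s′) ⋀⁺ (here refl) =
    F ∷ G ∷ [] , refl , s ∷ s′ ∷ [] , ℕ.s≤s (pair (size F) (size G) (ℕₚ.n≤1+n _))
  decompose (~ (_⋀_ {F} {G} s s′)) ⋀⁻ (here refl) =
    (~ F) ∷ [] , refl , (~ s) ∷ [] ,
    ℕ.s≤s (single (1 + size F) (ℕ.s≤s (ℕₚ.m≤n⇒m≤1+n (ℕₚ.m≤m+n (size F) (size G)))))
  decompose (~ (_⋀_ {F} {G} s s′)) ⋀⁻ (there (here refl)) =
    (~ G) ∷ [] , refl , (~ s′) ∷ [] ,
    ℕ.s≤s (single (1 + size G) (ℕ.s≤s (ℕₚ.m≤n⇒m≤1+n (ℕₚ.m≤n+m (size G) (size F)))))
  decompose (_⋁_ {F} {G} s s′) ⋁⁺ (here refl) =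
    F ∷ [] , refl , s ∷ [] ,
    ℕ.s≤s (single (size F) (ℕₚ.m≤n⇒m≤1+n (ℕₚ.m≤m+n (size F) (size G))))
  decompose (_⋁_ {F} {G} s s′) ⋁⁺ (there (here refl)) =
    G ∷ [] , refl , s′ ∷ [] ,
    ℕ.s≤s (single (size G) (ℕₚ.m≤n⇒m≤1+n (ℕₚ.m≤n+m (size G) (size F))))
  decompose (~ (_⋁_ {F} {G} s s′)) ⋁⁻ (here refl) =
    (~ F) ∷ (~ G) ∷ [] , refl , (~ s) ∷ (~ s′) ∷ [] ,
    ℕ.s≤s (pair (1 + size F) (1 + size G) (ℕₚ.≤-reflexive (cong suc (ℕₚ.+-suc (size F) (size G)))))
  decompose (_⊃_ {F} {G} s s′) ⊃⁺ (here refl) =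
    (~ F) ∷ [] , refl , (~ s) ∷ [] ,
    ℕ.s≤s (single (1 + size F) (ℕ.s≤s (ℕₚ.m≤m+n (size F) (size G))))
  decompose (_⊃_ {F} {G} s s′) ⊃⁺ (there (here refl)) =
    G ∷ [] , refl , s′ ∷ [] ,
    ℕ.s≤s (single (size G) (ℕₚ.m≤n⇒m≤1+n (ℕₚ.m≤n+m (size G) (size F))))
  decompose (~ (_⊃_ {F} {G} s s′)) ⊃⁻ (here refl) =
    F ∷ (~ G) ∷ [] , refl , s ∷ (~ s′) ∷ [] ,
    ℕ.s≤s (pair (size F) (1 + size G)
      (ℕₚ.≤-trans (ℕₚ.≤-reflexive (ℕₚ.+-suc (size F) (size G))) (ℕₚ.n≤1+n _)))

------------------------------------------------------------------------
-- Tokens covering a node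

  -- Ants stands for a list containing the antecedents of all conditionals of
  -- the root.
  module _ (Ants : List Propositional) where

    -- A list of antecedents that may still be boxed at some label.
    Budget : Set
    Budget = List Propositional

    -- V is a budget for x in N: all antecedents outside V are boxed at x.
    Budgeted : Node → Label → Budget → Set
    Budgeted N x V = ∀ {A} → A ∈ Ants → (x ∶ □~ A) ∈ N ⊎ A ∈ V

    -- The formulas that can never contribute to the creation of a label.
    data Light : LabelledFormula → Set where
      simple : ∀ {x F a} → Simple F → Light (x ∶ F ^ a)
      box    : ∀ {x A a} → Light (x ∶ □~ A ^ a)
      order  : ∀ {x y} → Light (x < y)

    -- The roles that a formula can play.  A complex formula stems from the root
    -- by propositional rules.  A conditional that has been used is followed by
    -- the labels it can still be used for, each with a budget.  A formula
    -- x : ¬□¬A, which can spawn a label, is followed by a budget for x.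
    data Entry : LabelledFormula → Set where
      light   : ∀ {φ} → Light φ → Entry φ
      complex : ∀ {x F a} → Over (_∈ Ants) F → Entry (x ∶ F ^ a)
      use     : ∀ {u A B L} → A ∈ Ants → List (Label × Budget) → Entry (u ∶ A |∼ B ^ L)
      spawn   : ∀ {x A a} → A ∈ Ants → Budget → Entry (x ∶ ~ (□~ A) ^ a)

    Token : Set
    Token = ∃ Entry

    -- The labels and budgets recorded in an entry are correct for N.
    Valid : ∀ {φ} → Node → Entry φ → Set
    Valid N (light _)   = ⊤
    Valid N (complex _) = ⊤
    Valid N (use {L = L} _ ps) =
      ∀ {x} → x Occurs N → x ∉ L → ∃[ V ] (x , V) ∈ ps × Budgeted N x V
    Valid N (spawn {x} _ V) = Budgeted N x V

    -- Each formula of N has a token in M.  Tokens without a formula in N are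
    -- harmless.
    Covers : Node → List Token → Set
    Covers N M = ∀ {φ} → φ ∈ N → ∃[ e ] (φ , e) ∈ M × Valid N e

    -- Labels, new to a conclusion, that every used conditional can now be used
    -- for.
    Grants : Set
    Grants = List (Label × Budget)

    grant : ∀ {φ} → Grants → Entry φ → Entry φ
    grant gs (light l)   = light l
    grant gs (complex o) = complex o
    grant gs (use i ps)  = use i (gs ++ ps)
    grant gs (spawn i V) = spawn i V

    grantToken : Grants → Token → Token
    grantToken gs (φ , e) = φ , grant gs e

    -- Every label occurring in C occurs in N or is granted a budget.
    Extends : Grants → Node → Node → Set
    Extends gs N C = ∀ {x} → x Occurs C → x Occurs N ⊎ ∃[ V ] (x , V) ∈ gs × Budgeted C x V

    KeepsBoxes : Node → Node → Set
    KeepsBoxes N C = ∀ {x A} → (x ∶ □~ A) ∈ N → (x ∶ □~ A) ∈ C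

    budgeted-mono : ∀ {N C x V} → KeepsBoxes N C → Budgeted N x V → Budgeted C x V
    budgeted-mono keeps b i = Sum.map₁ keeps (b i)

    valid-grant : ∀ {N C gs φ} (e : Entry φ) → KeepsBoxes N C → Extends gs N C →
      Valid N e → Valid C (grant gs e)
    valid-grant (light _)   keeps ext v = tt
    valid-grant (complex _) keeps ext v = tt
    valid-grant {gs = gs} (use _ ps) keeps ext v o x∉L with ext o
    ... | inj₂ (V , i , b) = V , ∈-++⁺ˡ i , b
    ... | inj₁ o′ = let V , i , b = v o′ x∉L in V , ∈-++⁺ʳ gs i , budgeted-mono keeps b
    valid-grant (spawn _ V) keeps ext v = budgeted-mono keeps v

    Valids : ∀ {Δ} → Node → All Entry Δ → Set
    Valids N []      = ⊤
    Valids N (e ∷ E) = Valid N e × Valids N E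

    -- The tokens of a conclusion: the token at p is replaced by the entries of
    -- the added formulas Δ, and the other tokens receive the grants.
    replace : ∀ {φ} {e : Entry φ} {Δ} → All Entry Δ → Grants →
      (M : List Token) → (φ , e) ∈ M → List Token
    replace E gs M p = All.toList E ++ map (grantToken gs) (M ─ p)

    ∈-entries : ∀ {C Δ} (E : All Entry Δ) → Valids C E →
      ∀ {φ} → φ ∈ Δ → ∃[ e ] (φ , e) ∈ All.toList E × Valid C e
    ∈-entries (e ∷ E) (v , vs) (here refl) = e , here refl , v
    ∈-entries (e ∷ E) (v , vs) (there i)   =
      let e′ , j , w = ∈-entries E vs i in e′ , there j , w

    covers-replace : ∀ {N C α Γ Δ gs M} {e : Entry α} →
      N ∼[ set ] (α ∷ Γ) → α ∉ Γ → C ∼[ set ] (Δ ++ Γ) →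
      KeepsBoxes N C → Extends gs N C → Covers N M →
      (p : (α , e) ∈ M) (E : All Entry Δ) → Valids C E → Covers C (replace E gs M p)
    covers-replace {Δ = Δ} {gs} N∼ α∉Γ C∼ keeps ext cov p E vs {φ} i
      with ∈-++⁻ Δ (Equivalence.to C∼ i)
    ... | inj₁ j = let e , k , v = ∈-entries E vs j in e , ∈-++⁺ˡ k , v
    ... | inj₂ j with cov (Equivalence.from N∼ (there j))
    ... | e , k , v with ∈-─ p k
    ... | inj₁ refl = contradiction j α∉Γ
    ... | inj₂ l = grant gs e , ∈-++⁺ʳ (All.toList E) (∈-map⁺ (grantToken gs) l) , valid-grant e keeps ext v

------------------------------------------------------------------------
-- The measure

    workload : Token → ℕ
    workload (_ , light _)           = 0
    workload (_ , complex {F = F} _) = size F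
    workload (_ , use _ _)           = 0
    workload (_ , spawn _ _)         = 0

    simpleWorkload : Token → ℕ
    simpleWorkload (_ , light (simple {F = F} _)) = size F
    simpleWorkload (_ , light box)                = 0
    simpleWorkload (_ , light order)              = 0
    simpleWorkload (_ , complex _)                = 0
    simpleWorkload (_ , use _ _)                  = 0
    simpleWorkload (_ , spawn _ _)                = 0

    -- Counts the conditionals in use.
    uses : Token → ℕ
    uses (_ , light _)   = 0
    uses (_ , complex _) = 0
    uses (_ , use _ _)   = 1
    uses (_ , spawn _ _) = 0

    -- A bound on the cost of spawning a label when c conditionals are in use and
    -- d antecedents are not boxed: the label spawned can be used by each of them,
    -- with d - 1 antecedents left.  For d = 0 the new label is inconsistent, which
    -- is accounted for by Mode.
    spawnCost : ℕ → ℕ → ℕ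
    spawnCost c zero    = 0
    spawnCost c (suc d) = suc (c * suc (spawnCost c d))

    -- The cost of using a conditional for a label.
    price : ℕ → Label × Budget → ℕ
    price c (_ , V) = suc (spawnCost c (length V))

    -- The cost of the spawning that a token still allows.
    growth : ℕ → Token → ℕ
    growth c (_ , light _)   = 0
    growth c (_ , complex _) = 0
    growth c (_ , use _ ps)  = total (price c) ps
    growth c (_ , spawn _ V) = spawnCost c (length V)

    total-map-grant : ∀ f gs → (∀ t → f (grantToken gs t) ≡ f t) →
      ∀ M → total f (map (grantToken gs) M) ≡ total f M
    total-map-grant f gs same []      = refl
    total-map-grant f gs same (t ∷ M) = cong₂ _+_ (same t) (total-map-grant f gs same M)

    workload-grant : ∀ gs t → workload (grantToken gs t) ≡ workload t
    workload-grant gs (_ , light _)   = refl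
    workload-grant gs (_ , complex _) = refl
    workload-grant gs (_ , use _ _)   = refl
    workload-grant gs (_ , spawn _ _) = refl

    uses-grant : ∀ gs t → uses (grantToken gs t) ≡ uses t
    uses-grant gs (_ , light _)   = refl
    uses-grant gs (_ , complex _) = refl
    uses-grant gs (_ , use _ _)   = refl
    uses-grant gs (_ , spawn _ _) = refl

    simpleWorkload-grant : ∀ gs t → simpleWorkload (grantToken gs t) ≡ simpleWorkload t
    simpleWorkload-grant gs (_ , light (simple _)) = refl
    simpleWorkload-grant gs (_ , light box)        = refl
    simpleWorkload-grant gs (_ , light order)      = refl
    simpleWorkload-grant gs (_ , complex _)        = refl
    simpleWorkload-grant gs (_ , use _ _)          = refl
    simpleWorkload-grant gs (_ , spawn _ _)        = refl

    growth-grant : ∀ c gs t →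
      growth c (grantToken gs t) ≡ uses t * total (price c) gs + growth c t
    growth-grant c gs (_ , light _)   = refl
    growth-grant c gs (_ , complex _) = refl
    growth-grant c gs (_ , use _ ps)  =
      trans (total-++ (price c) gs ps)
            (cong (_+ total (price c) ps) (sym (ℕₚ.*-identityˡ (total (price c) gs))))
    growth-grant c gs (_ , spawn _ _) = refl

    growth-map-grant : ∀ c gs M → total (growth c) (map (grantToken gs) M)
      ≡ total uses M * total (price c) gs + total (growth c) M
    growth-map-grant c gs []      = refl
    growth-map-grant c gs (t ∷ M) = begin
      growth c (grantToken gs t) + total (growth c) (map (grantToken gs) M)
        ≡⟨ cong₂ _+_ (growth-grant c gs t) (growth-map-grant c gs M) ⟩
      (u * g + growth c t) + (us * g + r)
        ≡⟨ rearrange u us g (growth c t) r ⟩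
      (u + us) * g + (growth c t + r) ∎
      where
      open ≡-Reasoning
      u us g r : ℕ
      u  = uses t
      us = total uses M
      g  = total (price c) gs
      r  = total (growth c) M
      rearrange : ∀ u us g h r → (u * g + h) + (us * g + r) ≡ (u + us) * g + (h + r)
      rearrange = solve-∀

    total-lights : ∀ f → (∀ {φ} (l : Light φ) → f (φ , light l) ≡ 0) →
      ∀ {Δ} (ls : All Light Δ) → total f (All.toList (All.map light ls)) ≡ 0
    total-lights f zero-on-light []       = refl
    total-lights f zero-on-light (l ∷ ls) =
      cong₂ _+_ (zero-on-light l) (total-lights f zero-on-light ls)

    Measure : Set
    Measure = ℕ × ℕ × ℕ × ℕ

    _≺_ : Measure → Measure → Set
    _≺_ = ×-Lex _≡_ ℕ._<_ (×-Lex _≡_ ℕ._<_ (×-Lex _≡_ ℕ._<_ ℕ._<_))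

    ≺-wellFounded : WellFounded _≺_
    ≺-wellFounded =
      ×-wellFounded <-wellFounded (×-wellFounded <-wellFounded (×-wellFounded <-wellFounded <-wellFounded))

    -- Either the rule for ¬□¬A may still be applied, or some label carries A and
    -- ¬A, which excludes this rule.  The index is the contribution to the measure.
    data Mode (N : Node) : ℕ → Set where
      growing : Mode N 1
      grown   : Inconsistent N → Mode N 0

    -- Q contains all pairs of labels of N whose relation is absent.
    Missing : Node → List (Label × Label) → Set
    Missing N Q = ∀ {x y} → x Occurs N → y Occurs N → (x < y) ∉ N → (x , y) ∈ Q

    -- A node with the data that bound the expansion still possible below it.
    record State (N : Node) : Set where
      field
        tokens  : List Token
        covers  : Covers N tokens
        {level} : ℕ
        mode    : Mode N level
        pairs   : List (Label × Label)
        missing : Missing N pairs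

      measure : Measure
      measure = level + total workload tokens
              , total (growth (total uses tokens)) tokens
              , length pairs
              , total simpleWorkload tokens

    open State

    -- The conclusion C of a rule applied to N has a state of smaller measure.
    Progress : ∀ {N} → State N → Node → Set
    Progress s C = ∃ λ (s′ : State C) → measure s′ ≺ measure s

------------------------------------------------------------------------
-- The effect of a rule on the measure

    -- A rule with principal formula α is applied to N; p is the token of α.
    module Application {N α Γ} (s : State N) (N∼ : N ∼[ set ] (α ∷ Γ)) (α∉Γ : α ∉ Γ)
                       {e : Entry α} (p : (α , e) ∈ tokens s) where

      -- The number of conditionals in use.
      c : ℕ
      c = total uses (tokens s)

      -- The conclusion C adds the formulas Δ.
      module Conclusion {Δ C} (C∼ : C ∼[ set ] (Δ ++ Γ)) (α≢box : ∀ {x A} → α ≢ (x ∶ □~ A)) where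

        Γ⊆C : Γ ⊆ C
        Γ⊆C i = Equivalence.from C∼ (∈-++⁺ʳ Δ i)

        Δ⊆C : Δ ⊆ C
        Δ⊆C i = Equivalence.from C∼ (∈-++⁺ˡ i)

        Γ⊆N : Γ ⊆ N
        Γ⊆N i = Equivalence.from N∼ (there i)

        α∈N : α ∈ N
        α∈N = Equivalence.from N∼ (here refl)

        kept : ∀ {φ} → φ ∈ N → α ≡ φ ⊎ φ ∈ C
        kept i with Equivalence.to N∼ i
        ... | here e  = inj₁ (sym e)
        ... | there j = inj₂ (Γ⊆C j)

        keepsBoxes : KeepsBoxes N C
        keepsBoxes i with kept i
        ... | inj₁ e = contradiction e α≢box
        ... | inj₂ j = j

        occurs-conclusion : ∀ {x} {X : Set} → All (λ φ → x OccursIn φ → x Occurs N ⊎ X) Δ →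
          x Occurs C → x Occurs N ⊎ X
        occurs-conclusion new o with Anyₚ.++⁻ Δ (Any-resp-⊆ (Equivalence.to C∼) o)
        ... | inj₂ o′ = inj₁ (Any-resp-⊆ Γ⊆N o′)
        ... | inj₁ o′ = let φ , i , oφ = find o′ in All.lookup new i oφ

        mode-step : ∀ {m} → (∀ {x F} → Simple F → α ≡ (x ∶ F) → Realised C x F) →
          Mode N m → Mode C m
        mode-step principal growing   = growing
        mode-step principal (grown d) = grown (inconsistent-step N∼ Γ⊆C principal d)

        total-replace : ∀ f gs → (∀ t → f (grantToken gs t) ≡ f t) → (E : All Entry Δ) →
          total f (replace E gs (tokens s) p) ≡ total f (All.toList E) + total f (tokens s ─ p)
        total-replace f gs same E = trans
          (total-++ f (All.toList E) _)
          (cong (total f (All.toList E) +_) (total-map-grant f gs same (tokens s ─ p)))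

        replace-≡ : ∀ f gs → (∀ t → f (grantToken gs t) ≡ f t) → (E : All Entry Δ) →
          total f (All.toList E) ≡ f (α , e) →
          total f (replace E gs (tokens s) p) ≡ total f (tokens s)
        replace-≡ f gs same E eq = trans (total-replace f gs same E)
          (trans (cong (_+ total f (tokens s ─ p)) eq) (sym (total-─ f p)))

        replace-< : ∀ f gs → (∀ t → f (grantToken gs t) ≡ f t) → (E : All Entry Δ) →
          total f (All.toList E) ℕ.< f (α , e) →
          total f (replace E gs (tokens s) p) ℕ.< total f (tokens s)
        replace-< f gs same E lt =
          subst₂ ℕ._<_ (sym (total-replace f gs same E)) (sym (total-─ f p))
            (ℕₚ.+-monoˡ-< (total f (tokens s ─ p)) lt)

        growth-replace : ∀ c gs → (E : All Entry Δ) →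
          total (growth c) (replace E gs (tokens s) p) ≡
          total (growth c) (All.toList E) + total uses (tokens s ─ p) * total (price c) gs
            + total (growth c) (tokens s ─ p)
        growth-replace c gs E = trans (total-++ (growth c) (All.toList E) _)
          (trans (cong (total (growth c) (All.toList E) +_) (growth-map-grant c gs (tokens s ─ p)))
                 (sym (ℕₚ.+-assoc (total (growth c) (All.toList E)) _ _)))

        advance : (E : All Entry Δ) → Valids C E → ∀ gs → Extends gs N C →
          ∀ {Q} → Missing C Q → ∀ {m} → Mode C m → State C
        advance E vs gs ext miss m = record
          { tokens  = replace E gs (tokens s) p
          ; covers  = covers-replace N∼ α∉Γ C∼ keepsBoxes ext (covers s) p E vs
          ; mode    = m
          ; pairs   = _
          ; missing = miss
          }

        -- The state of C with the entries E for Δ, the grants gs and the pairs Q;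
        -- the lemmas below compare its measure with that of s, one for each
        -- component that can decrease first.
        module Step (E : All Entry Δ) (vs : Valids C E) (gs : Grants) (ext : Extends gs N C)
                    {Q : List (Label × Label)} (miss : Missing C Q) where

          tokens′ : List Token
          tokens′ = replace E gs (tokens s) p

          by-level : Mode C 0 → level s ≡ 1 →
            total workload (All.toList E) ≡ workload (α , e) → Progress s C
          by-level m l≡1 w = advance E vs gs ext miss m , inj₁
            (subst₂ ℕ._<_ (sym (replace-≡ workload gs (workload-grant gs) E w))
              (cong (_+ total workload (tokens s)) (sym l≡1)) ℕₚ.≤-refl)

          module _ (m : Mode C (level s)) where

            by-workload : total workload (All.toList E) ℕ.< workload (α , e) → Progress s C
            by-workload w = advance E vs gs ext miss m , inj₁
              (ℕₚ.+-monoʳ-< (level s) (replace-< workload gs (workload-grant gs) E w))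

            module _ (w : total workload (All.toList E) ≡ workload (α , e))
                     (u : total uses (All.toList E) ≡ uses (α , e)) where

              workload-≡ : level s + total workload tokens′ ≡ level s + total workload (tokens s)
              workload-≡ = cong (level s +_) (replace-≡ workload gs (workload-grant gs) E w)

              uses-≡ : total uses (tokens s) ≡ total uses tokens′
              uses-≡ = sym (replace-≡ uses gs (uses-grant gs) E u)

              by-growth :
                total (growth c) (All.toList E) + total uses (tokens s ─ p) * total (price c) gs
                  ℕ.< growth c (α , e) → Progress s C
              by-growth g = advance E vs gs ext miss m , inj₂ (workload-≡ , inj₁
                (subst (λ c′ → total (growth c′) tokens′ ℕ.< total (growth c) (tokens s)) uses-≡
                  (subst₂ ℕ._<_ (sym (growth-replace c gs E)) (sym (total-─ (growth c) p))
                    (ℕₚ.+-monoˡ-< _ g))))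

              module _ (g : total (growth c) (All.toList E)
                         + total uses (tokens s ─ p) * total (price c) gs ≡ growth c (α , e)) where

                growth-≡ : total (growth (total uses tokens′)) tokens′ ≡ total (growth c) (tokens s)
                growth-≡ = subst (λ c′ → total (growth c′) tokens′ ≡ total (growth c) (tokens s)) uses-≡
                  (trans (growth-replace c gs E)
                    (trans (cong (_+ total (growth c) (tokens s ─ p)) g) (sym (total-─ (growth c) p))))

                by-pairs : length Q ℕ.< length (pairs s) → Progress s C
                by-pairs q = advance E vs gs ext miss m ,
                  inj₂ (workload-≡ , inj₂ (growth-≡ , inj₁ q))

                by-simpleWorkload : Q ≡ pairs s →
                  total simpleWorkload (All.toList E) ℕ.< simpleWorkload (α , e) → Progress s C
                by-simpleWorkload q sw = advance E vs gs ext miss m ,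
                  inj₂ (workload-≡ , inj₂ (growth-≡ , inj₂ (cong length q ,
                    replace-< simpleWorkload gs (simpleWorkload-grant gs) E sw)))

        missing-step : Extends [] N C → (∀ {x y} → α ≡ (x < y) → (x < y) ∈ C) →
          ∀ {Q} → Missing N Q → Missing C Q
        missing-step ext order-kept miss o o′ ∉C = miss (before o) (before o′) λ i →
          case kept i of λ { (inj₁ e) → ∉C (order-kept e) ; (inj₂ j) → ∉C j }
          where
          before : ∀ {x} → x Occurs C → x Occurs N
          before o with ext o
          ... | inj₁ o′ = o′
          ... | inj₂ (_ , () , _)

    allPairs : Node → List (Label × Label)
    allPairs N = cartesianProduct (labels N) (labels N)

    allPairs-missing : ∀ N → Missing N (allPairs N)
    allPairs-missing N o o′ _ =
      ∈-cartesianProduct⁺ (occurs⇒∈labels N o) (occurs⇒∈labels N o′)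

    lights : ∀ {Δ} → All Light Δ → All Entry Δ
    lights = All.map light

    lights-valid : ∀ {C Δ} (ls : All Light Δ) → Valids C (lights ls)
    lights-valid []       = tt
    lights-valid (l ∷ ls) = tt , lights-valid ls

    no-workload : ∀ {Δ} (ls : All Light Δ) → total workload (All.toList (lights ls)) ≡ 0
    no-workload = total-lights workload (λ _ → refl)

    no-uses : ∀ {Δ} (ls : All Light Δ) → total uses (All.toList (lights ls)) ≡ 0
    no-uses = total-lights uses (λ _ → refl)

    no-growth : ∀ c {Δ} (ls : All Light Δ) → total (growth c) (All.toList (lights ls)) ≡ 0
    no-growth c = total-lights (growth c) (λ _ → refl)

    simples : ∀ x {Fs} → All Simple Fs → All Light (map (x ∶_) Fs)
    simples x []       = []
    simples x (s ∷ ss) = simple s ∷ simples x ss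

    total-simples : ∀ x {Fs} (ss : All Simple Fs) →
      total simpleWorkload (All.toList (lights (simples x ss))) ≡ total size Fs
    total-simples x []       = refl
    total-simples x (_∷_ {x = F} s ss) = cong (size F +_) (total-simples x ss)

    complexes : ∀ x {Fs} → All (Over (_∈ Ants)) Fs → All Entry (map (x ∶_) Fs)
    complexes x []       = []
    complexes x (o ∷ os) = complex o ∷ complexes x os

    complexes-valid : ∀ {C} x {Fs} (os : All (Over (_∈ Ants)) Fs) → Valids C (complexes x os)
    complexes-valid x []       = tt
    complexes-valid x (o ∷ os) = tt , complexes-valid x os

    total-complexes : ∀ x {Fs} (os : All (Over (_∈ Ants)) Fs) →
      total workload (All.toList (complexes x os)) ≡ total size Fs
    total-complexes x []       = refl
    total-complexes x (_∷_ {x = F} o os) = cong (size F +_) (total-complexes x os)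

    over-≢box : ∀ {P x F a} → Over P F → ∀ {y A} → (x ∶ F ^ a) ≢ (y ∶ □~ A)
    over-≢box () refl

    same-label : ∀ {N x Fs z} {X : Set} → x Occurs N →
      All (λ φ → z OccursIn φ → z Occurs N ⊎ X) (map (x ∶_) Fs)
    same-label {N} x∈N = Allₚ.map⁺ (All.universal
      (λ F o → inj₁ (subst (_Occurs N) (sym (occursIn-initial F o)) x∈N)) _)

    no-growth-or-grants : ∀ c u {Δ} (ls : All Light Δ) →
      total (growth c) (All.toList (lights ls)) + u * 0 ≡ 0
    no-growth-or-grants c u ls = cong₂ _+_ (no-growth c ls) (ℕₚ.*-zeroʳ u)

------------------------------------------------------------------------
-- Each rule decreases the measure

    propositional-progress : ∀ {N α Γ Ds D C} (s : State N) → N ∼[ set ] (α ∷ Γ) → α ∉ Γ →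
      PropositionalRule Γ α Ds → D ∈ Ds → C ∼[ set ] D → Progress s C
    propositional-progress {N} {α} {Γ} {Ds} {D} {C} s N∼ α∉Γ r D∈ C∼
      with covers s (Equivalence.from N∼ (here refl))
    ... | light box   , _ = case r of λ ()
    ... | light order , _ = case r of λ ()
    ... | use _ _     , _ = case r of λ ()
    ... | spawn _ _   , _ = case r of λ ()
    ... | complex {x} {F} {a} o , p , _ = go (decompose o r D∈)
      where
      open Application s N∼ α∉Γ p
      go : ∃[ Fs ] D ≡ map (x ∶_) Fs ++ Γ × All (Over (_∈ Ants)) Fs × total size Fs ℕ.< size F →
        Progress s C
      go (Fs , refl , os , lt) = by-workload
        (mode-step (λ { _ refl → principal-realised r D∈ (Equivalence.from C∼) }) (mode s))
        (subst (ℕ._< size F) (sym (total-complexes x os)) lt)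
        where
        open Conclusion {map (x ∶_) Fs} C∼ (over-≢box o)
        ext : Extends [] N C
        ext = occurs-conclusion (same-label (lose α∈N world))
        open Step (complexes x os) (complexes-valid {C} x os) [] ext
          (missing-step ext (λ ()) (missing s))
    ... | light (simple {x} {F} o) , p , _ = go (decompose o r D∈)
      where
      open Application s N∼ α∉Γ p
      go : ∃[ Fs ] D ≡ map (x ∶_) Fs ++ Γ × All Simple Fs × total size Fs ℕ.< size F →
        Progress s C
      go (Fs , refl , ss , lt) = by-simpleWorkload
        (mode-step (λ { _ refl → principal-realised r D∈ (Equivalence.from C∼) }) (mode s))
        (no-workload ls) (no-uses ls) (no-growth-or-grants c (total uses (tokens s ─ p)) ls) refl
        (subst (ℕ._< size F) (sym (total-simples x ss)) lt)
        where
        open Conclusion {map (x ∶_) Fs} C∼ (over-≢box o)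
        ls : All Light (map (x ∶_) Fs)
        ls = simples x ss
        ext : Extends [] N C
        ext = occurs-conclusion (same-label (lose α∈N world))
        open Step (lights ls) (lights-valid {C} ls) [] ext
          (missing-step ext (λ ()) (missing s))

    transferred-lights : ∀ Γ x y → All Light (Γ ^M[ x ↦ y ])
    transferred-lights Γ x y = All.map
      (λ { (negation A) → simple (~ ⌜ A ⌝-simple) ; (box A) → box }) (transferred Γ x y)

    transferred-label : ∀ Γ x y {z} {X : Set} → (z ≡ y → X) →
      All (λ φ → z OccursIn φ → X) (Γ ^M[ x ↦ y ])
    transferred-label Γ x y f = All.map
      (λ { (negation A) o → f (occursIn-initial (~ ⌜ A ⌝) o)
         ; (box A)      o → f (occursIn-initial (□~ A) o) }) (transferred Γ x y)

    -- Both conclusions of the order rule add an absent relation a < b between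
    -- labels of the premise, and transfer boxes to a label w of the premise.
    order-progress : ∀ {N Γ x y a b v w C} (s : State N) → N ∼[ set ] ((x < y) ∷ Γ) → (x < y) ∉ Γ →
      a Occurs N → b Occurs N → w Occurs N → (a < b) ∉ N →
      C ∼[ set ] ((x < y) ∷ (a < b) ∷ Γ ^M[ v ↦ w ] ++ Γ) → Progress s C
    order-progress {N} {Γ} {x} {y} {a} {b} {v} {w} {C} s N∼ α∉Γ a∈N b∈N w∈N ab∉N C∼
      with covers s (Equivalence.from N∼ (here refl))
    ... | light order , p , _ = by-pairs (mode-step (λ { _ () }) (mode s))
      (no-workload ls) (no-uses ls) (no-growth-or-grants c (total uses (tokens s ─ p)) ls)
      (subst (length (pairs s ─ q) ℕ.<_) (sym (length-removeAt′ (pairs s) (Any.index q))) ℕₚ.≤-refl)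
      where
      open Application s N∼ α∉Γ p
      open Conclusion {(x < y) ∷ (a < b) ∷ Γ ^M[ v ↦ w ]} C∼ (λ ())
      ls : All Light ((x < y) ∷ (a < b) ∷ Γ ^M[ v ↦ w ])
      ls = order ∷ order ∷ transferred-lights Γ v w
      ext : Extends [] N C
      ext = occurs-conclusion
        ( (λ o → inj₁ (lose α∈N o))
        ∷ (λ { left → inj₁ a∈N ; right → inj₁ b∈N })
        ∷ transferred-label Γ v w (λ { refl → inj₁ w∈N }))
      q : (a , b) ∈ pairs s
      q = missing s a∈N b∈N ab∉N
      miss : Missing C (pairs s ─ q)
      miss o o′ ∉C with ∈-─ q (missing-step ext (λ { refl → Δ⊆C (here refl) }) (missing s) o o′ ∉C)
      ... | inj₁ refl = contradiction (Δ⊆C (there (here refl))) ∉C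
      ... | inj₂ i    = i
      open Step (lights ls) (lights-valid {C} ls) [] ext miss

    -- The shapes of the formulas that the rule for A |∼ B adds: ¬A and B are
    -- propositional, and ¬□¬A can spawn a label.
    data Added (A : Propositional) : Formula → Set where
      simple : ∀ {F} → Simple F → Added A F
      spawn  : Added A (~ (□~ A))

    module _ {A : Propositional} (i : A ∈ Ants) (V : Budget) where

      added-entry : ∀ {x F} → Added A F → Entry (x ∶ F)
      added-entry (simple s) = light (simple s)
      added-entry spawn      = spawn i V

      added-valid : ∀ {N x F} (d : Added A F) → Budgeted N x V → Valid N (added-entry {x} d)
      added-valid (simple s) b = tt
      added-valid spawn      b = b

      added-workload : ∀ {x F} (d : Added A F) → workload (_ , added-entry {x} d) ≡ 0
      added-workload (simple s) = refl
      added-workload spawn      = refl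

      added-uses : ∀ {x F} (d : Added A F) → uses (_ , added-entry {x} d) ≡ 0
      added-uses (simple s) = refl
      added-uses spawn      = refl

      added-growth : ∀ c {x F} (d : Added A F) →
        growth c (_ , added-entry {x} d) ℕ.≤ spawnCost c (length V)
      added-growth c (simple s) = ℕ.z≤n
      added-growth c spawn      = ℕₚ.≤-refl

    -- Each conclusion of the rule for A |∼ B used for x adds some x : F.
    conditional⁺-progress : ∀ {N Γ u A B L x F C} (s : State N) →
      N ∼[ set ] ((u ∶ A |∼ B ^ L) ∷ Γ) → (u ∶ A |∼ B ^ L) ∉ Γ →
      x Occurs N → x ∉ L → Added A F →
      C ∼[ set ] ((x ∶ F) ∷ (u ∶ A |∼ B ^ (L ∷ʳ x)) ∷ Γ) → Progress s C
    conditional⁺-progress {N} {Γ} {u} {A} {B} {L} {x} {F} {C} s N∼ α∉Γ x∈N x∉L d C∼ =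
      dispatch (covers s (Equivalence.from N∼ (here refl)))
      where
      α : LabelledFormula
      α = u ∶ A |∼ B ^ L

      -- Whether α has been used before or not, its new entry is that of a used
      -- conditional, with x deleted from the usable labels ps.  The workload
      -- drops if α was complex; otherwise the cost drops, since the price of x
      -- exceeds the cost of F.
      convert : ∀ (e : Entry α) → (α , e) ∈ tokens s → ∀ i ps → Valid N (use {u} {A} {B} {L} i ps) →
        workload (α , e) ≡ 1 ⊎ e ≡ use i ps → Progress s C
      convert e p i ps v _ with v x∈N x∉L
      convert e p i ps v kind | V , q , b = reduce kind
        where
        open Application s N∼ α∉Γ p
        open Conclusion {(x ∶ F) ∷ (u ∶ A |∼ B ^ (L ∷ʳ x)) ∷ []} C∼ (λ ())
        E : All Entry ((x ∶ F) ∷ (u ∶ A |∼ B ^ (L ∷ʳ x)) ∷ [])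
        E = added-entry i V d ∷ use i (ps ─ q) ∷ []

        annotation-occurs : ∀ {z} → z ∈ L ∷ʳ x → z Occurs N
        annotation-occurs j with ∈-++⁻ L j
        ... | inj₁ k           = lose α∈N (annotation k)
        ... | inj₂ (here refl) = x∈N

        before : ∀ {z} → z Occurs C → z Occurs N ⊎ ⊥
        before = occurs-conclusion
          ( (λ o → inj₁ (subst (_Occurs N) (sym (occursIn-initial F o)) x∈N))
          ∷ (λ { world → inj₁ (lose α∈N world) ; (annotation j) → inj₁ (annotation-occurs j) })
          ∷ [])

        ext : Extends [] N C
        ext o = Sum.map₂ ⊥-elim (before o)

        still : Valid C (use {u} {A} {B} {L ∷ʳ x} i (ps ─ q))
        still o z∉ with before o
        ... | inj₁ o′ with v o′ (z∉ ∘ ∈-++⁺ˡ)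
        ... | V′ , r , b′ with ∈-─ q r
        ... | inj₁ refl = contradiction (∈-++⁺ʳ L (here refl)) z∉
        ... | inj₂ r′   = V′ , r′ , budgeted-mono keepsBoxes b′

        open Step E (added-valid i V d (budgeted-mono keepsBoxes b) , still , tt) [] ext
          (missing-step ext (λ ()) (missing s))

        mode′ : Mode C (level s)
        mode′ = mode-step (λ { (conditional ()) refl }) (mode s)

        workload-E : total workload (All.toList E) ≡ 0
        workload-E = cong (_+ 0) (added-workload i V d)

        reduce : workload (α , e) ≡ 1 ⊎ e ≡ use i ps → Progress s C
        reduce (inj₁ w)    = by-workload mode′ (subst₂ ℕ._<_ (sym workload-E) (sym w) (ℕ.s≤s ℕ.z≤n))
        reduce (inj₂ refl) = by-growth mode′ workload-E (cong (_+ 1) (added-uses i V d)) cheaper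
          where
          open ℕₚ.≤-Reasoning
          cheaper : total (growth c) (All.toList E) + total uses (tokens s ─ p) * 0
            ℕ.< total (price c) ps
          cheaper = begin-strict
            growth c (x ∶ F , added-entry i V d) + (total (price c) (ps ─ q) + 0)
              + total uses (tokens s ─ p) * 0
              ≡⟨ cong₂ (λ m n → growth c (x ∶ F , added-entry i V d) + m + n)
                   (ℕₚ.+-identityʳ _) (ℕₚ.*-zeroʳ (total uses (tokens s ─ p))) ⟩
            growth c (x ∶ F , added-entry i V d) + total (price c) (ps ─ q) + 0
              ≡⟨ ℕₚ.+-identityʳ _ ⟩
            growth c (x ∶ F , added-entry i V d) + total (price c) (ps ─ q)
              <⟨ ℕₚ.+-monoˡ-< _ (ℕ.s≤s (added-growth i V c d)) ⟩
            price c (x , V) + total (price c) (ps ─ q)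
              ≡⟨ total-─ (price c) q ⟨
            total (price c) ps ∎

      dispatch : ∃[ e ] (α , e) ∈ tokens s × Valid N e → Progress s C
      dispatch (light (simple (conditional ())) , _)
      -- At its first use, the conditional is usable for all labels of N, with
      -- the whole of Ants as a budget.
      dispatch (e@(complex (conditional i)) , p , _) =
        convert e p i (map (_, Ants) (labels N))
          (λ o _ → Ants , ∈-map⁺ (_, Ants) (occurs⇒∈labels N o) , inj₂) (inj₁ refl)
      dispatch (e@(use i ps) , p , v) = convert e p i ps v (inj₂ refl)

    -- The new label x starts with the whole of Ants as its budget; the principal
    -- formula is complex, so the workload drops and the cost may rise.
    conditional⁻-progress : ∀ {N Γ u A B x C} (s : State N) →
      N ∼[ set ] ((u ∶ ~ (A |∼ B)) ∷ Γ) → (u ∶ ~ (A |∼ B)) ∉ Γ →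
      C ∼[ set ] ((x ∶ ⌜ A ⌝) ∷ (x ∶ □~ A) ∷ (x ∶ ~ ⌜ B ⌝) ∷ Γ) → Progress s C
    conditional⁻-progress {N} {Γ} {u} {A} {B} {x} {C} s N∼ α∉Γ C∼
      with covers s (Equivalence.from N∼ (here refl))
    ... | light (simple (~ conditional ())) , _
    ... | complex (~ conditional i) , p , _ = by-workload
      (mode-step (λ { (~ conditional ()) refl }) (mode s))
      (subst (ℕ._< 2) (sym (no-workload ls)) (ℕ.s≤s ℕ.z≤n))
      where
      open Application s N∼ α∉Γ p
      open Conclusion {(x ∶ ⌜ A ⌝) ∷ (x ∶ □~ A) ∷ (x ∶ ~ ⌜ B ⌝) ∷ []} C∼ (λ ())
      ls : All Light ((x ∶ ⌜ A ⌝) ∷ (x ∶ □~ A) ∷ (x ∶ ~ ⌜ B ⌝) ∷ [])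
      ls = simple ⌜ A ⌝-simple ∷ box ∷ simple (~ ⌜ B ⌝-simple) ∷ []
      granted : ∀ {z} → z ≡ x → z Occurs N ⊎ ∃[ V ] (z , V) ∈ [ x , Ants ] × Budgeted C z V
      granted refl = inj₂ (Ants , here refl , inj₂)
      ext : Extends [ x , Ants ] N C
      ext = occurs-conclusion
        ( (λ o → granted (occursIn-initial ⌜ A ⌝ o))
        ∷ (λ o → granted (occursIn-initial (□~ A) o))
        ∷ (λ o → granted (occursIn-initial (~ ⌜ B ⌝) o)) ∷ [])
      open Step (lights ls) (lights-valid {C} ls) [ x , Ants ] ext (allPairs-missing C)

    box-progress : ∀ {N Γ x A y C} (s : State N) → ¬ Axiom N → Saturated N →
      N ∼[ set ] ((x ∶ ~ (□~ A)) ∷ Γ) → (x ∶ ~ (□~ A)) ∉ Γ →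
      C ∼[ set ] ((y < x) ∷ Γ ^M[ x ↦ y ] ++ (y ∶ ⌜ A ⌝) ∷ (y ∶ □~ A) ∷ Γ) → Progress s C
    box-progress {N} {Γ} {x} {A} {y} {C} s open′ saturated N∼ α∉Γ C∼
      with covers s (Equivalence.from N∼ (here refl))
    ... | light (simple (~ ())) , _
    ... | complex (~ ()) , _
    ... | spawn i V , p , b = spawned (b i)
      where
      open Application s N∼ α∉Γ p
      Δ : Node
      Δ = (y < x) ∷ Γ ^M[ x ↦ y ] ++ (y ∶ ⌜ A ⌝) ∷ (y ∶ □~ A) ∷ []
      C∼Δ++Γ : C ∼[ set ] (Δ ++ Γ)
      C∼Δ++Γ = subst (λ D → C ∼[ set ] ((y < x) ∷ D))
        (sym (++-assoc (Γ ^M[ x ↦ y ]) ((y ∶ ⌜ A ⌝) ∷ (y ∶ □~ A) ∷ []) Γ)) C∼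
      open Conclusion {Δ} C∼Δ++Γ (λ ())

      ls : All Light Δ
      ls = order ∷ Allₚ.++⁺ (transferred-lights Γ x y) (simple ⌜ A ⌝-simple ∷ box ∷ [])

      A∈C : (y ∶ ⌜ A ⌝) ∈ C
      A∈C = Δ⊆C (there (∈-++⁺ʳ (Γ ^M[ x ↦ y ]) (here refl)))

      □~A∈C : (y ∶ □~ A) ∈ C
      □~A∈C = Δ⊆C (there (∈-++⁺ʳ (Γ ^M[ x ↦ y ]) (there (here refl))))

      inherited : ∀ {A′} → (x ∶ □~ A′) ∈ N → (y ∶ ~ ⌜ A′ ⌝) ∈ C × (y ∶ □~ A′) ∈ C
      inherited j with Equivalence.to N∼ j
      ... | there k = Product.map (Δ⊆C ∘ there ∘ ∈-++⁺ˡ) (Δ⊆C ∘ there ∘ ∈-++⁺ˡ) (transfer-box y k)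

      ext : ∀ {W} → Budgeted C y W → Extends [ y , W ] N C
      ext {W} bW {z} = occurs-conclusion
        ( (λ { left → granted refl ; right → inj₁ (lose α∈N world) })
        ∷ Allₚ.++⁺ (transferred-label Γ x y granted)
            ( (λ o → granted (occursIn-initial ⌜ A ⌝ o))
            ∷ (λ o → granted (occursIn-initial (□~ A) o)) ∷ []))
        where
        granted : z ≡ y → z Occurs N ⊎ ∃[ U ] (z , U) ∈ [ y , W ] × Budgeted C z U
        granted refl = inj₂ (W , here refl , bW)

      not-grown : ∀ {m} → Mode N m → m ≡ 1
      not-grown growing   = refl
      not-grown (grown d) = contradiction d (saturated-inconsistent open′ saturated)

      -- If □¬A is already at x, then y is inconsistent and only the mode matters;
      -- otherwise A leaves the budget on the way from x to y.
      spawned : (x ∶ □~ A) ∈ N ⊎ A ∈ V → Progress s C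
      spawned (inj₁ boxed) = by-level
        (grown (y , A , present A∈C , present (proj₁ (inherited boxed))))
        (not-grown (mode s)) (no-workload ls)
        where
        open Step (lights ls) (lights-valid {C} ls) [ y , Ants ] (ext inj₂) (allPairs-missing C)
      spawned (inj₂ q) = by-growth
        (mode-step (λ { (~ ()) refl }) (mode s)) (no-workload ls) (no-uses ls) cheaper
        where
        remaining : Budgeted C y (V ─ q)
        remaining j with b j
        ... | inj₁ k = inj₁ (proj₂ (inherited k))
        ... | inj₂ k with ∈-─ q k
        ... | inj₁ refl = inj₁ □~A∈C
        ... | inj₂ l    = inj₂ l
        d : ℕ
        d = length (V ─ q)
        cheaper : total (growth c) (All.toList (lights ls))
          + total uses (tokens s ─ p) * (suc (spawnCost c d) + 0) ℕ.< spawnCost c (length V)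
        cheaper = ℕₚ.≤-reflexive (begin
          suc (total (growth c) (All.toList (lights ls))
            + total uses (tokens s ─ p) * (suc (spawnCost c d) + 0))
            ≡⟨ cong₂ (λ m n → suc (m + total uses (tokens s ─ p) * n))
                 (no-growth c ls) (ℕₚ.+-identityʳ (suc (spawnCost c d))) ⟩
          suc (total uses (tokens s ─ p) * suc (spawnCost c d))
            ≡⟨ cong (λ n → suc (n * suc (spawnCost c d))) (total-─ uses p) ⟨
          spawnCost c (suc d)
            ≡⟨ cong (spawnCost c) (length-removeAt′ V (Any.index q)) ⟨
          spawnCost c (length V) ∎)
          where open ≡-Reasoning
        open Step (lights ls) (lights-valid {C} ls) [ y , (V ─ q) ] (ext remaining) (allPairs-missing C)

    pointwise : ∀ {P : Node → Set} {Cs Ds} → Pointwise _∼[ set ]_ Cs Ds →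
      (∀ {C D} → D ∈ Ds → C ∼[ set ] D → P C) → All P Cs
    pointwise []       f = []
    pointwise (e ∷ es) f = f (here refl) e ∷ pointwise es (f ∘ there)

    progress : ∀ {N Cs} (s : State N) → N ⟶ Cs → All (Progress s) Cs
    progress {N} s (propositional _ (Γ , α , Ds , N∼ , α∉Γ , r , Cs∼Ds)) =
      pointwise Cs∼Ds (propositional-progress s N∼ α∉Γ r)
    progress s (conditionalOrOrder _ (Γ , _ , _ , N∼ , α∉Γ , |∼⁺ {A = A} {B} x o x∉L , C₁ ∷ C₂ ∷ C₃ ∷ [])) =
      conditional⁺-progress s N∼ α∉Γ x∈N x∉L (simple (~ ⌜ A ⌝-simple)) C₁ ∷
      conditional⁺-progress s N∼ α∉Γ x∈N x∉L spawn C₂ ∷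
      conditional⁺-progress s N∼ α∉Γ x∈N x∉L (simple ⌜ B ⌝-simple) C₃ ∷ []
      where
      x∈N = Any-resp-⊆ (Equivalence.from N∼) o
    progress s (conditionalOrOrder _ (Γ , _ , _ , N∼ , α∉Γ , |∼⁻ x _ , C₁ ∷ [])) =
      conditional⁻-progress s N∼ α∉Γ C₁ ∷ []
    progress s (conditionalOrOrder _ (Γ , _ , _ , N∼ , α∉Γ , <-rule {x} {y} z o xz∉ zy∉ , C₁ ∷ C₂ ∷ [])) =
      order-progress s N∼ α∉Γ z∈N y∈N z∈N (zy∉ ∘ Equivalence.to N∼) C₁ ∷
      order-progress s N∼ α∉Γ x∈N z∈N x∈N (xz∉ ∘ Equivalence.to N∼) C₂ ∷ []
      where
      z∈N = Any-resp-⊆ (Equivalence.from N∼) o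
      x∈N = lose (Equivalence.from N∼ (here refl)) left
      y∈N = lose (Equivalence.from N∼ (here refl)) right
    progress s (box open′ saturated (Γ , _ , _ , N∼ , α∉Γ , □⁻ y _ , C₁ ∷ [])) =
      box-progress s open′ saturated N∼ α∉Γ C₁ ∷ []

------------------------------------------------------------------------
-- Termination and the initial state

    state⇒terminating : ∀ {N} (s : State N) → Acc _≺_ (measure s) → Terminating N
    state⇒terminating s (acc smaller) = terminating λ step →
      All.map (λ (s′ , lt) → state⇒terminating s′ (smaller lt)) (progress s step)

    initial-state : ∀ x₀ {Γ} → All (Over (_∈ Ants)) Γ → State (map (x₀ ∶_) Γ)
    initial-state x₀ {Γ} os = record
      { tokens  = All.toList (complexes x₀ os)
      ; covers  = ∈-entries (complexes x₀ os) (complexes-valid x₀ os)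
      ; mode    = growing
      ; pairs   = _
      ; missing = allPairs-missing (map (x₀ ∶_) Γ)
      }

  antecedents : Formula → List Propositional
  antecedents (var _)  = []
  antecedents (A |∼ _) = A ∷ []
  antecedents (□~ _)   = []
  antecedents (~ F)    = antecedents F
  antecedents (F ⋀ G)  = antecedents F ++ antecedents G
  antecedents (F ⋁ G)  = antecedents F ++ antecedents G
  antecedents (F ⊃ G)  = antecedents F ++ antecedents G

  over-antecedents : ∀ {As F} → In𝓛 F → antecedents F ⊆ As → Over (_∈ As) F
  over-antecedents (var P)  _ = var P
  over-antecedents (A |∼ B) ⊆As = conditional (⊆As (here refl))
  over-antecedents (~ i)    ⊆As = ~ over-antecedents i ⊆As
  over-antecedents (_⋀_ {F} i j) ⊆As =
    over-antecedents i (⊆As ∘ ∈-++⁺ˡ) ⋀ over-antecedents j (⊆As ∘ ∈-++⁺ʳ (antecedents F))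
  over-antecedents (_⋁_ {F} i j) ⊆As =
    over-antecedents i (⊆As ∘ ∈-++⁺ˡ) ⋁ over-antecedents j (⊆As ∘ ∈-++⁺ʳ (antecedents F))
  over-antecedents (_⊃_ {F} i j) ⊆As =
    over-antecedents i (⊆As ∘ ∈-++⁺ˡ) ⊃ over-antecedents j (⊆As ∘ ∈-++⁺ʳ (antecedents F))

  all-over : ∀ {As Γ} → All In𝓛 Γ → concatMap antecedents Γ ⊆ As → All (Over (_∈ As)) Γ
  all-over []            _   = []
  all-over {Γ = F ∷ _} (i ∷ is) ⊆As =
    over-antecedents i (⊆As ∘ ∈-++⁺ˡ) ∷ all-over is (⊆As ∘ ∈-++⁺ʳ (antecedents F))

theorem6p11 : (ATM : Set) → let open TRT ATM in
    (Γ : List Formula) → All In𝓛 Γ →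
    (t : Tree) → IsTableauFor Γ t → Finite t
theorem6p11 ATM Γ Γ⊆𝓛 t (x₀ , tableau) =
  finite ATM tableau (state⇒terminating ATM Ants s₀ (≺-wellFounded ATM Ants _))
  where
  open TRT ATM
  Ants : List Propositional
  Ants = concatMap (antecedents ATM) Γ
  s₀ : State ATM Ants (map (x₀ ∶_) Γ)
  s₀ = initial-state ATM Ants x₀ (all-over ATM Γ⊆𝓛 id)
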